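{- Let $\mathcal{P}$ be a bilateral parking procedure, and let $W\mapsto\widehat{\mathcal{P}}(W)=(P,Q)$ be the associated $\mathcal{P}$-correspondence. (i) A word $W$ is $\mathcal{P}$-parking if the common shape of $(P,Q)=\widehat{\mathcal{P}}(W)$ is a tree with support of the form $\{1,2,\ldots,r\}$. (ii) The $\mathcal{P}$-correspondence $\widehat{\mathcal{P}}$ is injective on $\mathbb{Z}^*$. (iii) For every word $W$ with $\widehat{\mathcal{P}}(W)=(P,Q)$, the canonical label of a node is equal to the spot where the corresponding car parked: if the node has label $k$ in $Q$, its canonical label is the spot in which the $k$th car parked.
   Context: $\mathbb{Z}^*$ is the set of finite words on $\mathbb{Z}$, $\epsilon$ the empty word, $\mathrm{Fin}(\mathbb{Z})$ the set of finite subsets of $\mathbb{Z}$. A parking procedure is a function $\mathcal{P}:\mathbb{Z}^*\to\mathrm{Fin}(\mathbb{Z})$ with $\mathcal{P}(\epsilon)=\emptyset$ such that for every word $a_1\cdots a_r$ with $r\ge1$: (1) $\#\mathcal{P}(a_1\cdots a_r)=r$ and $\mathcal{P}(a_1\cdots a_i)\subset\mathcal{P}(a_1\cdots a_{i+1})$ for $i<r$; (2) if $a_r\notin\mathcal{P}(a_1\cdots a_{r-1})$ then $\mathcal{P}(a_1\cdots a_r)=\mathcal{P}(a_1\cdots a_{r-1})\sqcup\{a_r\}$. The spot where the $i$th car parks is $\mathrm{ls}_{\mathcal{P}}(a_1\cdots a_i)$, the unique element of $\mathcal{P}(a_1\cdots a_i)\setminus\mathcal{P}(a_1\cdots a_{i-1})$.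 A block of $S\subset\mathbb{Z}$ is a maximal nonempty interval of consecutive integers contained in $S$. $\mathcal{P}$ is bilateral if whenever $a\in\mathcal{P}(W)$ lies in the block $\{t,\ldots,u\}$ of $\mathcal{P}(W)$, $\mathrm{ls}_{\mathcal{P}}(Wa)\in\{t-1,u+1\}$. A word $W$ of length $r$ is $\mathcal{P}$-parking if $\mathcal{P}(W)=\{1,\ldots,r\}$. The outcome function $\pi_{\mathcal{P}}(W)$ of $W=a_1\cdots a_r$ is the bijection $\mathcal{P}(W)\to\{1,\ldots,r\}$ sending an occupied spot $k$ to the index $i$ such that the $i$th car parked in $k$, i.e. $\mathrm{ls}_{\mathcal{P}}(a_1\cdots a_i)=k$. A (plane) binary tree is either empty or a node with a left and a right binary subtree; its size is its number of nodes. An indexed forest is the data of a finite set $S\subset\mathbb{Z}$ (its support) and, for each block $I$ of $S$, a binary tree of size $|I|$. Its canonical labeling labels, for each block $I$, the nodes of the corresponding tree by the elements of $I$ increasingly in in-order (left subtree, root, right subtree); nodes are thereby identified with elements of $S$. Binary trees of size $r$ are identified with indexed forests with support $\{1,\ldots,r\}$. A decreasing forest is an indexed forest with $r$ nodes labeled bijectively by $\{1,\ldots,r\}$ so that each node has a larger label than all its descendants. Given $W=a_1\cdots a_r$, $\widehat{\mathcal{P}}(W)=(P,Q)$ is the pair of labeled indexed forests of the same shape $F$ defined as follows. The forest $Q$ is the unique decreasing forest with support $\mathcal{P}(W)$ whose node with canonical label $i$ has label $q_i=\pi_{\mathcal{P}}(W)(i)$ (on each block, this is the decreasing binary tree of the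 corresponding sequence of distinct values: the root is the position of the maximum, and the left and right subtrees are constructed recursively from the positions to the left and to the right). $F$ is its underlying indexed forest, and $P$ is $F$ with node $i$ labeled by $p_i=a_{q_i}$. -}

module Defs where

open import Data.Fin.Base as Fin using (Fin; toℕ)
import Data.Fin.Properties as Fin
open import Data.Integer.Base using (ℤ; +_; 0ℤ; 1ℤ; _+_; _-_; -_; _≤_; ∣_∣; +≤+)
import Data.Integer.Properties as ℤ
open import Data.List.Base using (List; initLast; _∷ʳ′_; []; _∷_; _∷ʳ_; _++_; length; lookup; take; tabulate)
import Data.List.Membership.Propositional as List
import Data.List.Membership.DecPropositional as DecMembership
open import Data.List.Membership.Propositional.Properties using (∈-∃++; ∈-++⁻; ∈-++⁺ˡ; ∈-++⁺ʳ)
open import Data.List.Properties using (length-++; length-tabulate; take-suc; take-all)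
open import Data.List.Relation.Unary.All as All using (All; []; _∷_)
import Data.List.Relation.Unary.All.Properties as All
open import Data.List.Relation.Unary.AllPairs using ([]; _∷_)
open import Data.List.Relation.Unary.Any using (here; there)
open import Data.List.Relation.Unary.Unique.Propositional using (Unique)
open import Data.Nat.Base as ℕ using (ℕ; zero; suc; z≤n; s≤s)
import Data.Nat.Properties as ℕ
open import Data.Product.Base using (∃; ∃-syntax; _×_; _,_; proj₁; proj₂)
open import Data.Sum.Base using (inj₁; inj₂)
open import Data.Tree.Binary using (Tree; leaf; node; mapₙ; #nodes)
open import Data.Tree.Binary.Properties using (#nodes-mapₙ; map-compose)
open import Data.Unit.Base using (⊤; tt)
open import Function.Base using (const; _∘_)
open import Level using (0ℓ)
open import Relation.Binary.PropositionalEquality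
  using (_≡_; _≢_; refl; sym; trans; cong; cong₂; subst; module ≡-Reasoning)
open import Relation.Nullary.Decidable using (yes; no; recompute; decidable-stable)
open import Relation.Nullary.Negation using (contradiction)
open import Relation.Unary using (Pred; _∈_; _∉_; _⊆_; _≐_; _∪_; ∅; ｛_｝)

open DecMembership ℤ._≟_ using (_∈?_)

-- The order of the elements is immaterial: finite sets are only ever
-- compared through _≐_ on their underlying predicates.
record FinSet : Set where
  field
    elements : List ℤ
    unique   : Unique elements

open FinSet public

⟦_⟧ : FinSet → Pred ℤ 0ℓ
⟦ S ⟧ k = k List.∈ elements S

#_ : FinSet → ℕ
# S = length (elements S)

[_⋯_] : ℤ → ℤ → Pred ℤ 0ℓ
[ t ⋯ u ] k = t ≤ k × k ≤ u

record IsBlock (S : Pred ℤ 0ℓ) (t u : ℤ) : Set where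
  field
    nonempty  : t ≤ u
    contained : [ t ⋯ u ] ⊆ S
    maximal   : ∀ {t′ u′} → [ t ⋯ u ] ⊆ [ t′ ⋯ u′ ] → [ t′ ⋯ u′ ] ⊆ S →
                [ t′ ⋯ u′ ] ⊆ [ t ⋯ u ]

-- Irrelevance of the proof makes a block nothing more than its two
-- endpoints, so that data indexed by blocks cannot depend on the proof.
record Block (S : Pred ℤ 0ℓ) : Set where
  constructor block
  field
    lo hi    : ℤ
    .isBlock : IsBlock S lo hi

open Block public using (lo; hi)

∣_∣ᵇ : ∀ {S} → Block S → ℕ
∣ I ∣ᵇ = suc ∣ hi I - lo I ∣

record ParkingProcedure : Set where
  field
    park      : List ℤ → FinSet
    park-ε    : ⟦ park [] ⟧ ≐ ∅
    park-size : ∀ W a → # park (W ∷ʳ a) ≡ length (W ∷ʳ a)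
    park-mono : ∀ W a → ⟦ park W ⟧ ⊆ ⟦ park (W ∷ʳ a) ⟧
    park-free : ∀ W a → a ∉ ⟦ park W ⟧ → ⟦ park (W ∷ʳ a) ⟧ ≐ ⟦ park W ⟧ ∪ ｛ a ｝

unique-length-≤ : ∀ {xs ys : List ℤ} → Unique xs →
                  (∀ {k} → k List.∈ xs → k List.∈ ys) → length xs ℕ.≤ length ys
unique-length-≤ {[]} _ _ = z≤n
unique-length-≤ {x ∷ xs} (x∉xs ∷ uniq) xs⊆ys with ∈-∃++ (xs⊆ys (here refl))
... | ls , rs , refl = ℕ.≤-trans (s≤s (unique-length-≤ uniq xs⊆ls++rs)) (ℕ.≤-reflexive eq)
  where
  xs⊆ls++rs : ∀ {k} → k List.∈ xs → k List.∈ ls ++ rs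
  xs⊆ls++rs k∈xs with ∈-++⁻ ls (xs⊆ys (there k∈xs))
  ... | inj₁ k∈ls         = ∈-++⁺ˡ k∈ls
  ... | inj₂ (here refl)  = contradiction refl (All.lookup x∉xs k∈xs)
  ... | inj₂ (there k∈rs) = ∈-++⁺ʳ ls k∈rs

  eq : suc (length (ls ++ rs)) ≡ length (ls ++ x ∷ rs)
  eq = begin
    suc (length (ls ++ rs))           ≡⟨ cong suc (length-++ ls) ⟩
    suc (length ls ℕ.+ length rs)     ≡⟨ ℕ.+-suc (length ls) (length rs) ⟨
    length ls ℕ.+ suc (length rs)     ≡⟨ length-++ ls ⟨
    length (ls ++ x ∷ rs)             ∎
    where open ≡-Reasoning

outside : ∀ {xs ys : List ℤ} → Unique xs → length ys ℕ.< length xs →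
          ∃[ k ] k List.∈ xs × k List.∉ ys
outside {xs} {ys} uniq ys<xs with All.all? (_∈? ys) xs
... | yes xs⊆ys = contradiction (unique-length-≤ uniq (All.lookup xs⊆ys)) (ℕ.<⇒≱ ys<xs)
... | no  xs⊈ys = List.find (All.¬All⇒Any¬ (_∈? ys) xs xs⊈ys)

module _ (𝒫 : ParkingProcedure) where
  open ParkingProcedure 𝒫

  #park≡length : ∀ W → # park W ≡ length W
  #park≡length W with initLast W
  #park≡length .(W ∷ʳ a) | W ∷ʳ′ a = park-size W a
  #park≡length .[]       | [] with elements (park []) | proj₁ park-ε
  ... | []    | _    = refl
  ... | k ∷ _ | noneIn = contradiction (noneIn (here refl)) λ ()

  #park-∷ʳ : ∀ W a → # park (W ∷ʳ a) ≡ suc (# park W)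
  #park-∷ʳ W a = begin
    # park (W ∷ʳ a)     ≡⟨ #park≡length (W ∷ʳ a) ⟩
    length (W ∷ʳ a)     ≡⟨ length-++ W ⟩
    length W ℕ.+ 1      ≡⟨ ℕ.+-comm (length W) 1 ⟩
    suc (length W)      ≡⟨ cong suc (#park≡length W) ⟨
    suc (# park W)      ∎
    where open ≡-Reasoning

  newSpot : ∀ W a → ∃[ k ] k ∈ ⟦ park (W ∷ʳ a) ⟧ × k ∉ ⟦ park W ⟧
  newSpot W a = outside (unique (park (W ∷ʳ a))) (ℕ.≤-reflexive (sym (#park-∷ʳ W a)))

  lastSpot : List ℤ → ℤ → ℤ
  lastSpot W a = proj₁ (newSpot W a)

  lastSpot-unique : ∀ W a {k} → k ∈ ⟦ park (W ∷ʳ a) ⟧ → k ∉ ⟦ park W ⟧ → lastSpot W a ≡ k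
  lastSpot-unique W a {k} k∈ k∉ with newSpot W a
  ... | s , s∈ , s∉ = decidable-stable (s ℤ.≟ k) λ s≢k →
    ℕ.<⇒≱ (ℕ.≤-refl {suc (suc (# park W))})
      (subst (suc (suc (# park W)) ℕ.≤_) (#park-∷ʳ W a)
        (unique-length-≤
          ((s≢k ∷ All.¬Any⇒All¬ _ s∉) ∷ All.¬Any⇒All¬ _ k∉ ∷ unique (park W))
          λ { (here refl)         → s∈
            ; (there (here refl)) → k∈
            ; (there (there p))   → park-mono W a p }))

  Bilateral : Set
  Bilateral = ∀ W a t u → a ∈ ⟦ park W ⟧ → IsBlock ⟦ park W ⟧ t u → a ∈ [ t ⋯ u ] →
              lastSpot W a ∈ ｛ t - 1ℤ ｝ ∪ ｛ u + 1ℤ ｝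

  IsParking : List ℤ → Set
  IsParking W = ⟦ park W ⟧ ≐ [ 1ℤ ⋯ + length W ]

  -- Cars are numbered from 0 here: spot W i is where car a_{i+1} of
  -- W = a_1 ⋯ a_r parks.
  spot : ∀ W → Fin (length W) → ℤ
  spot W i = lastSpot (take (toℕ i) W) (lookup W i)

  parkedAt : ∀ W {k} → k ∈ ⟦ park W ⟧ → ∃[ i ] spot W i ≡ k
  parkedAt W {k} k∈ = search (length W) ℕ.≤-refl
    (subst (λ V → k ∈ ⟦ park V ⟧) (sym (take-all (length W) W ℕ.≤-refl)) k∈)
    where
    search : ∀ n → n ℕ.≤ length W → k ∈ ⟦ park (take n W) ⟧ → ∃[ i ] spot W i ≡ k
    search zero    _   k∈ = contradiction (proj₁ park-ε k∈) λ ()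
    search (suc n) n<r k∈ with k ∈? elements (park (take n W))
    ... | yes k∈′ = search n (ℕ.<⇒≤ n<r) k∈′
    ... | no  k∉  = i , lastSpot-unique (take (toℕ i) W) (lookup W i)
        (subst (λ V → k ∈ ⟦ park V ⟧) (trans (cong (λ m → take (suc m) W) (sym toℕ-i)) (take-suc W i)) k∈)
        (subst (λ m → k ∉ ⟦ park (take m W) ⟧) (sym toℕ-i) k∉)
      where
      i     = Fin.fromℕ< n<r
      toℕ-i = Fin.toℕ-fromℕ< n<r

  outcome : ∀ W {k} → k ∈ ⟦ park W ⟧ → Fin (length W)
  outcome W k∈ = proj₁ (parkedAt W k∈)

  -- Cars are numbered from 1 here.
  CarParksIn : List ℤ → ℕ → ℤ → Set
  CarParksIn W j s = ∃[ i ] suc (toℕ i) ≡ j × spot W i ≡ s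

BinTree : Set → Set
BinTree A = Tree A ⊤

private variable
  A B : Set

data Node {A : Set} : BinTree A → Set where
  root  : ∀ {l x r} → Node (node l x r)
  left  : ∀ {l x r} → Node l → Node (node l x r)
  right : ∀ {l x r} → Node r → Node (node l x r)

label : {t : BinTree A} → Node t → A
label {t = node l x r} root      = x
label {t = node l x r} (left ν)  = label ν
label {t = node l x r} (right ν) = label ν

-- The in-order labelling of the nodes by k, k + 1, k + 2, …
inorder : {t : BinTree A} → ℤ → Node t → ℤ
inorder {t = node l x r} k root      = k + + #nodes l
inorder {t = node l x r} k (left ν)  = inorder k ν
inorder {t = node l x r} k (right ν) = inorder (k + + #nodes l + 1ℤ) ν

-- Indexed forests with node labels in A; an unlabelled indexed forest is
-- a Forest ⊤.
record Forest (A : Set) : Set where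
  field
    support   : FinSet
    tree      : Block ⟦ support ⟧ → BinTree A
    size-tree : ∀ I → #nodes (tree I) ≡ ∣ I ∣ᵇ

open Forest public

mapForest : (A → B) → Forest A → Forest B
mapForest f F = record
  { support   = support F
  ; tree      = λ I → mapₙ f (tree F I)
  ; size-tree = λ I → trans (#nodes-mapₙ f (tree F I)) (size-tree F I)
  }

shape : Forest A → Forest ⊤
shape = mapForest (const tt)

canonicalLabel : (F : Forest A) (I : Block ⟦ support F ⟧) → Node (tree F I) → ℤ
canonicalLabel F I = inorder (lo I)

infix 4 _≈_ _≈²_

record _≈_ {A : Set} (F G : Forest A) : Set where
  field
    support-≈ : ⟦ support F ⟧ ≐ ⟦ support G ⟧
    tree-≈    : ∀ I J → lo I ≡ lo J → hi I ≡ hi J → tree F I ≡ tree G J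

_≈²_ : Forest A × Forest B → Forest A × Forest B → Set
(F , G) ≈² (F′ , G′) = F ≈ F′ × G ≈ G′

-- The identification of binary trees of size r with indexed forests of
-- support {1,…,r}.  For r = 0 there is no block, and the empty tree is
-- identified with the empty forest.
record _IsTree_ {A : Set} (F : Forest A) (T : BinTree A) : Set where
  field
    support-T : ⟦ support F ⟧ ≐ [ 1ℤ ⋯ + #nodes T ]
    tree-T    : ∀ I → tree F I ≡ T

-- Only used on words with distinct letters, where the maximum, and hence
-- the split, is unique.
record MaxSplit {r : ℕ} (w : List (Fin r)) : Set where
  field
    before after : List (Fin r)
    max          : Fin r
    split        : w ≡ before ++ max ∷ after
    before≤max   : All (Fin._≤ max) before
    after≤max    : All (Fin._≤ max) after

  length-split : length w ≡ length before ℕ.+ suc (length after)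
  length-split = trans (cong length split) (length-++ before)

open MaxSplit

maxSplit : ∀ {r} (x : Fin r) w → MaxSplit (x ∷ w)
maxSplit x [] = record
  { before = [] ; after = [] ; max = x ; split = refl ; before≤max = [] ; after≤max = [] }
maxSplit x (y ∷ w) with maxSplit y w
... | m with Fin.≤-total x (max m)
...   | inj₁ x≤max = record
  { before = x ∷ before m ; after = after m ; max = max m ; split = cong (x ∷_) (split m)
  ; before≤max = x≤max ∷ before≤max m ; after≤max = after≤max m }
...   | inj₂ max≤x = record
  { before = [] ; after = y ∷ w ; max = x ; split = refl ; before≤max = []
  ; after≤max = subst (All (Fin._≤ x)) (sym (split m))
      (All.++⁺ (All.map (λ p → ℕ.≤-trans p max≤x) (before≤max m))
        (max≤x ∷ All.map (λ p → ℕ.≤-trans p max≤x) (after≤max m))) }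

-- The first argument only bounds the recursion.
decreasingTree′ : ∀ {r} n (w : List (Fin r)) → length w ℕ.≤ n → BinTree (Fin r)
decreasingTree′ n       []      _  = leaf tt
decreasingTree′ (suc n) (x ∷ w) le =
  node (decreasingTree′ n (before m) before≤n) (max m) (decreasingTree′ n (after m) after≤n)
  where
  m = maxSplit x w

  total≤n : length (before m) ℕ.+ length (after m) ℕ.≤ n
  total≤n = ℕ.≤-pred (ℕ.≤-trans
    (ℕ.≤-reflexive (sym (trans (length-split m) (ℕ.+-suc _ _)))) le)

  before≤n = ℕ.≤-trans (ℕ.m≤m+n _ _) total≤n
  after≤n  = ℕ.≤-trans (ℕ.m≤n+m _ _) total≤n

decreasingTree : ∀ {r} → List (Fin r) → BinTree (Fin r)
decreasingTree w = decreasingTree′ (length w) w ℕ.≤-refl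

#nodes-decreasingTree′ : ∀ {r} n (w : List (Fin r)) le → #nodes (decreasingTree′ n w le) ≡ length w
#nodes-decreasingTree′ n       []      _  = refl
#nodes-decreasingTree′ (suc n) (x ∷ w) le = trans
  (cong₂ (λ l r → l ℕ.+ suc r) (#nodes-decreasingTree′ n (before m) _) (#nodes-decreasingTree′ n (after m) _))
  (sym (length-split m))
  where m = maxSplit x w

spotOf : (S : FinSet) (I : Block ⟦ S ⟧) (j : Fin ∣ I ∣ᵇ) → lo I + + toℕ j ∈ ⟦ S ⟧
spotOf S (block t u b) j = recompute (t + + toℕ j ∈? elements S) (member b)
  where
  member : IsBlock ⟦ S ⟧ t u → t + + toℕ j ∈ ⟦ S ⟧
  member b = contained (ℤ.i≤i+j t (+ toℕ j) , (begin
    t + + toℕ j        ≤⟨ ℤ.+-monoʳ-≤ t (+≤+ (ℕ.≤-pred (Fin.toℕ<n j))) ⟩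
    t + + ∣ u - t ∣    ≡⟨ cong (λ z → t + z) (ℤ.0≤i⇒+∣i∣≡i (ℤ.i≤j⇒0≤j-i nonempty)) ⟩
    t + (u - t)        ≡⟨ ℤ.+-comm t (u - t) ⟩
    u - t + t          ≡⟨ ℤ.+-assoc u (- t) t ⟩
    u + (- t + t)    ≡⟨ cong (λ z → u + z) (ℤ.+-inverseˡ t) ⟩
    u + 0ℤ             ≡⟨ ℤ.+-identityʳ u ⟩
    u                  ∎))
    where
    open IsBlock b
    open ℤ.≤-Reasoning

module _ (𝒫 : ParkingProcedure) where
  open ParkingProcedure 𝒫

  outcomeAt : ∀ W (I : Block ⟦ park W ⟧) → Fin ∣ I ∣ᵇ → Fin (length W)
  outcomeAt W I j = outcome 𝒫 W (spotOf (park W) I j)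

  outcomes : ∀ W → Block ⟦ park W ⟧ → List (Fin (length W))
  outcomes W I = tabulate (outcomeAt W I)

  -- Q, with its labels shifted to {0,…,r-1}.
  decreasingForest : ∀ W → Forest (Fin (length W))
  decreasingForest W = record
    { support   = park W
    ; tree      = λ I → decreasingTree (outcomes W I)
    ; size-tree = λ I → trans (#nodes-decreasingTree′ _ (outcomes W I) _) (length-tabulate (outcomeAt W I))
    }

  P-forest : List ℤ → Forest ℤ
  P-forest W = mapForest (lookup W) (decreasingForest W)

  Q-forest : List ℤ → Forest ℕ
  Q-forest W = mapForest (suc ∘ toℕ) (decreasingForest W)

  correspondence : List ℤ → Forest ℤ × Forest ℕ
  correspondence W = P-forest W , Q-forest W

  same-shape : ∀ W → shape (P-forest W) ≈ shape (Q-forest W)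
  same-shape W = record
    { support-≈ = (λ k∈ → k∈) , (λ k∈ → k∈)
    ; tree-≈    = λ { I (block _ _ _) refl refl →
        trans (sym (map-compose (tree (decreasingForest W) I)))
              (map-compose (tree (decreasingForest W) I)) }
    }

{-# OPTIONS --safe #-}
module Submission where

-- Reading a decreasing tree in in-order gives back the sequence of outcomes it
-- was built from, so the node with canonical label k carries in Q the number of
-- the car parked in k; this is (iii).  For (ii), every car parks in some block
-- of 𝒫(W) and no two cars in the same spot, so the in-order readings of P and Q
-- list all the pairs (i , aᵢ).  For (i), 𝒫(W) has as many elements as W has letters.

open import Defs
import Data.Integer.Properties as ℤ
open import Algebra.Properties.AbelianGroup ℤ.+-0-abelianGroup
  using (⁻¹-injective; ∙-cancelˡ; xyx⁻¹≈y; //-rightDividesˡ; //-rightDividesʳ)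
open import Data.Fin.Base as Fin using (Fin; toℕ; fromℕ<)
import Data.Fin.Properties as Fin
open import Data.Integer.Base using (ℤ; +_; 1ℤ; _+_; _-_; -_; _≤_; ∣_∣; +≤+; pred)
  renaming (suc to sucℤ)
open import Data.List.Base using (List; []; _∷_; _∷ʳ_; _++_; length; lookup; map; take; drop; tabulate)
import Data.List.Membership.DecPropositional as DecMembership
open import Data.List.Membership.Propositional.Properties using (∈-tabulate⁺; ∈-tabulate⁻)
open import Data.List.Properties
  using ( ∷-injectiveˡ; ∷-injectiveʳ; ++-assoc; ++-identityʳ; ∷ʳ-++; length-++; length-tabulate
        ; map-++; map-tabulate; take++drop≡id; take-all; take-suc; take-take )
open import Data.List.Relation.Binary.Pointwise using (lookup⁻; Pointwise-≡⇒≡)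
open import Data.List.Relation.Unary.Unique.Propositional.Properties using (tabulate⁺)
open import Data.Nat.Base as ℕ using (ℕ; zero; suc; z≤n; s≤s)
import Data.Nat.Properties as ℕ
open import Data.Product.Base using (∃₂; ∃-syntax; _×_; _,_; proj₁; proj₂)
open import Data.Sum.Base using (inj₁; inj₂)
open import Data.Tree.Binary using (leaf; node; mapₙ; #nodes)
open import Function.Base using (_∘_)
open import Level using (0ℓ)
open import Relation.Binary.PropositionalEquality
  using (_≡_; refl; sym; trans; cong; cong₂; subst; _≗_; module ≡-Reasoning)
open import Relation.Nullary.Decidable using (yes; no; decidable-stable)
open import Relation.Nullary.Negation using (contradiction)
open import Relation.Unary using (Pred; Decidable; _∈_; _∉_; _⊆_; _≐_)
open import Relation.Unary.Properties using (≐-sym; ≐-trans)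

open DecMembership ℤ._≟_ using (_∈?_)

private variable
  A B : Set

-- In-order readings of binary trees

tabulate-injective : ∀ {n} {f g : Fin n → A} → tabulate f ≡ tabulate g → f ≗ g
tabulate-injective eq Fin.zero    = ∷-injectiveˡ eq
tabulate-injective eq (Fin.suc j) = tabulate-injective (∷-injectiveʳ eq) j

tabulate-split : ∀ {n} {f : Fin n → A} ls {x rs} → tabulate f ≡ ls ++ x ∷ rs →
                 ∃[ j ] toℕ j ≡ length ls × f j ≡ x
tabulate-split {n = suc n} []       eq = Fin.zero , refl , ∷-injectiveˡ eq
tabulate-split {n = suc n} (_ ∷ ls) eq with tabulate-split ls (∷-injectiveʳ eq)
... | j , j≡ , fj≡x = Fin.suc j , cong suc j≡ , fj≡x

inorderList : BinTree A → List A
inorderList (leaf _)     = []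
inorderList (node l x r) = inorderList l ++ x ∷ inorderList r

length-inorderList : (t : BinTree A) → length (inorderList t) ≡ #nodes t
length-inorderList (leaf _)     = refl
length-inorderList (node l x r) = trans (length-++ (inorderList l))
  (cong₂ (λ m n → m ℕ.+ suc n) (length-inorderList l) (length-inorderList r))

inorderList-mapₙ : (f : A → B) (t : BinTree A) → inorderList (mapₙ f t) ≡ map f (inorderList t)
inorderList-mapₙ f (leaf _)     = refl
inorderList-mapₙ f (node l x r) = trans
  (cong₂ (λ xs ys → xs ++ f x ∷ ys) (inorderList-mapₙ f l) (inorderList-mapₙ f r))
  (sym (map-++ f (inorderList l) (x ∷ inorderList r)))

-- Cutting the reading at ν turns the recursively defined canonical label into a count: it exceeds k
-- by the number of nodes read before ν.
inorder-split : {t : BinTree A} (k : ℤ) (ν : Node t) →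
  ∃₂ λ ls rs → inorderList t ≡ ls ++ label ν ∷ rs × k + + length ls ≡ inorder k ν
inorder-split {t = node l x r} k root =
  inorderList l , inorderList r , refl , cong (λ n → k + + n) (length-inorderList l)
inorder-split {t = node l x r} k (left ν) with inorder-split k ν
... | ls , rs , eq , pos = ls , rs ++ x ∷ inorderList r ,
  trans (cong (_++ x ∷ inorderList r) eq) (++-assoc ls (label ν ∷ rs) (x ∷ inorderList r)) , pos
inorder-split {t = node l x r} k (right ν) with inorder-split (k + + #nodes l + 1ℤ) ν
... | ls , rs , eq , pos = inorderList l ++ x ∷ ls , rs ,
  trans (cong (λ ys → inorderList l ++ x ∷ ys) eq) (sym (++-assoc (inorderList l) (x ∷ ls) (label ν ∷ rs))) ,
  trans offset pos
  where
  open ≡-Reasoning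
  -- The nodes read before ν are those of `l`, the root, which accounts for the `1ℤ`, and the nodes
  -- of `r` listed in `ls`.
  offset : k + + length (inorderList l ++ x ∷ ls) ≡ k + + #nodes l + 1ℤ + + length ls
  offset = begin
    k + + length (inorderList l ++ x ∷ ls)       ≡⟨ cong (λ n → k + + n) (length-++ (inorderList l)) ⟩
    k + (+ length (inorderList l) + (1ℤ + + length ls))
      ≡⟨ cong (λ n → k + (+ n + (1ℤ + + length ls))) (length-inorderList l) ⟩
    k + (+ #nodes l + (1ℤ + + length ls))        ≡⟨ ℤ.+-assoc k (+ #nodes l) (1ℤ + + length ls) ⟨
    k + + #nodes l + (1ℤ + + length ls)          ≡⟨ ℤ.+-assoc (k + + #nodes l) 1ℤ (+ length ls) ⟨
    k + + #nodes l + 1ℤ + + length ls            ∎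

inorder-tabulate : ∀ {n} {g : Fin n → A} {t : BinTree A} (k : ℤ) (ν : Node t) →
  inorderList t ≡ tabulate g → ∃[ j ] g j ≡ label ν × k + + toℕ j ≡ inorder k ν
inorder-tabulate k ν t≡g with inorder-split k ν
... | ls , _ , eq , pos with tabulate-split ls (trans (sym t≡g) eq)
...   | j , j≡ , gj≡ = j , gj≡ , trans (cong (λ n → k + + n) j≡) pos

-- Each recursive step cuts the word into `before`, `max` and `after`; the in-order reading glues
-- these pieces back in the same order.
inorderList-decreasingTree′ : ∀ {r} n (w : List (Fin r)) le → inorderList (decreasingTree′ n w le) ≡ w
inorderList-decreasingTree′ n       []      _  = refl
inorderList-decreasingTree′ (suc n) (x ∷ w) le = trans
  (cong₂ (λ xs ys → xs ++ max ∷ ys)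
    (inorderList-decreasingTree′ n before _) (inorderList-decreasingTree′ n after _))
  (sym split)
  where open MaxSplit (maxSplit x w)

-- Blocks of finite sets of integers

firstExit : {P : Pred ℕ 0ℓ} → Decidable P → P 0 → ∀ N → N ∉ P →
            ∃[ n ] (∀ {i} → i ℕ.≤ n → P i) × suc n ∉ P
firstExit         P? p0 zero    ¬pN = contradiction p0 ¬pN
firstExit {P = P} P? p0 (suc N) ¬pN with P? 1
... | no ¬p1 = 0 , (λ { z≤n → p0 }) , ¬p1
... | yes p1 with firstExit {P = P ∘ suc} (P? ∘ suc) p1 N ¬pN
...   | n , within , beyond = suc n , (λ { z≤n → p0 ; (s≤s i≤n) → within i≤n }) , beyond

-- Pigeonhole: the values of f at 0, ..., `# S` are `# S` + 1 distinct integers, so one of them lies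
-- outside S and bounds the search of `firstExit`.
firstExit-finite : ∀ S {f : ℕ → ℤ} → (∀ {i j} → f i ≡ f j → i ≡ j) → f 0 ∈ ⟦ S ⟧ →
                   ∃[ n ] (∀ {i} → i ℕ.≤ n → f i ∈ ⟦ S ⟧) × f (suc n) ∉ ⟦ S ⟧
firstExit-finite S {f} f-inj f0∈S
  with outside (tabulate⁺ {n = suc (# S)} {f = f ∘ toℕ} (Fin.toℕ-injective ∘ f-inj))
               (ℕ.≤-reflexive (sym (length-tabulate (f ∘ toℕ {suc (# S)}))))
... | _ , k∈ , k∉S with ∈-tabulate⁻ {f = f ∘ toℕ} k∈
...   | i , refl = firstExit (λ i → f i ∈? elements S) f0∈S (toℕ i) k∉S

-- An interval that contains [t, u] and a point x < t also contains t - 1, and one with a point x >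
-- u also contains u + 1; neither neighbour lies in S.
isMaximal⇒isBlock : ∀ {S : Pred ℤ 0ℓ} {t u} →
                    t ≤ u → [ t ⋯ u ] ⊆ S → pred t ∉ S → sucℤ u ∉ S → IsBlock S t u
isMaximal⇒isBlock {t = t} {u} t≤u ⊆S t-1∉S u+1∉S = record
  { nonempty  = t≤u
  ; contained = ⊆S
  ; maximal   = λ sub sub′ {x} (t′≤x , x≤u′) →
      let t′≤t , _ = sub (ℤ.≤-refl , t≤u)
          _ , u≤u′ = sub (t≤u , ℤ.≤-refl)
      in decidable-stable (t ℤ.≤? x) (λ t≰x → let x≤t-1 = ℤ.i<j⇒i≤pred[j] (ℤ.≰⇒> t≰x) in
           t-1∉S (sub′ (ℤ.≤-trans t′≤x x≤t-1 ,
             ℤ.i≤j⇒pred[i]≤j (ℤ.≤-trans t≤u u≤u′))))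
       , decidable-stable (x ℤ.≤? u) (λ x≰u → let u+1≤x = ℤ.i<j⇒suc[i]≤j (ℤ.≰⇒> x≰u) in
           u+1∉S (sub′ (ℤ.≤-trans t′≤t (ℤ.≤-trans t≤u (ℤ.i≤suc[i] u)) , ℤ.≤-trans u+1≤x x≤u′)))
  }

i≤j⇒i+∣j-i∣≡j : ∀ {i j} → i ≤ j → i + + ∣ j - i ∣ ≡ j
i≤j⇒i+∣j-i∣≡j {i} {j} i≤j = begin
  i + + ∣ j - i ∣   ≡⟨ cong (λ n → i + n) (ℤ.0≤i⇒+∣i∣≡i (ℤ.i≤j⇒0≤j-i i≤j)) ⟩
  i + (j - i)       ≡⟨ ℤ.+-assoc i j (- i) ⟨
  i + j - i         ≡⟨ xyx⁻¹≈y i j ⟩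
  j                 ∎
  where open ≡-Reasoning

j≤i+n⇒∣j-i∣≤n : ∀ {i j n} → i ≤ j → j ≤ i + + n → ∣ j - i ∣ ℕ.≤ n
j≤i+n⇒∣j-i∣≤n {i} {j} {n} i≤j j≤i+n = ℤ.drop‿+≤+ (begin
  + ∣ j - i ∣       ≡⟨ ℤ.0≤i⇒+∣i∣≡i (ℤ.i≤j⇒0≤j-i i≤j) ⟩
  j - i             ≤⟨ ℤ.+-monoˡ-≤ (- i) j≤i+n ⟩
  i + + n - i       ≡⟨ xyx⁻¹≈y i (+ n) ⟩
  + n               ∎)
  where open ℤ.≤-Reasoning

-- Walk from k to the left and to the right until the next integer is outside S; the last integers
-- reached are the endpoints of the block.
blockAround : ∀ S {k} → k ∈ ⟦ S ⟧ → ∃₂ λ t u → IsBlock ⟦ S ⟧ t u × k ∈ [ t ⋯ u ]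
blockAround S {k} k∈S
  with firstExit-finite S {λ i → k - + i} (ℤ.+-injective ∘ ⁻¹-injective ∘ ∙-cancelˡ k _ _)
         (subst ⟦ S ⟧ (sym (ℤ.+-identityʳ k)) k∈S)
     | firstExit-finite S {λ i → k + + i} (ℤ.+-injective ∘ ∙-cancelˡ k _ _)
         (subst ⟦ S ⟧ (sym (ℤ.+-identityʳ k)) k∈S)
... | m , below , t-1∉S | n , above , u+1∉S =
  k - + m , k + + n ,
  isMaximal⇒isBlock (ℤ.≤-trans t≤k k≤u) ⊆S
    (subst (_∉ ⟦ S ⟧) (ℤ.minus-suc k m) t-1∉S)
    (subst (_∉ ⟦ S ⟧) k+1+n u+1∉S) ,
  t≤k , k≤u
  where
  t≤k = ℤ.i-j≤i k (+ m)
  k≤u = ℤ.i≤i+j k (+ n)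

  k+1+n : k + + suc n ≡ sucℤ (k + + n)
  k+1+n = begin
    k + (1ℤ + + n)   ≡⟨ ℤ.+-assoc k 1ℤ (+ n) ⟨
    k + 1ℤ + + n     ≡⟨ cong (_+ + n) (ℤ.+-comm k 1ℤ) ⟩
    1ℤ + k + + n     ≡⟨ ℤ.+-assoc 1ℤ k (+ n) ⟩
    1ℤ + (k + + n)   ∎
    where open ≡-Reasoning

  ⊆S : [ k - + m ⋯ k + + n ] ⊆ ⟦ S ⟧
  -- The distance from x to k is at most m on the left and n on the right, so x was visited by one
  -- of the two walks.
  ⊆S {x} (t≤x , x≤u) with ℤ.≤-total x k
  ... | inj₁ x≤k = subst ⟦ S ⟧ k-∣k-x∣≡x (below (j≤i+n⇒∣j-i∣≤n x≤k k≤x+m))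
    where
    k≤x+m = subst (_≤ x + + m) (//-rightDividesˡ (+ m) k) (ℤ.+-monoˡ-≤ (+ m) t≤x)
    k-∣k-x∣≡x = trans (cong (_- + ∣ k - x ∣) (sym (i≤j⇒i+∣j-i∣≡j x≤k)))
      (//-rightDividesʳ (+ ∣ k - x ∣) x)
  ... | inj₂ k≤x = subst ⟦ S ⟧ (i≤j⇒i+∣j-i∣≡j k≤x) (above (j≤i+n⇒∣j-i∣≤n k≤x x≤u))

spotOf-surjective : ∀ {S} (I : Block S) {k} → k ∈ [ lo I ⋯ hi I ] →
                    ∃[ j ] lo I + + toℕ {∣ I ∣ᵇ} j ≡ k
spotOf-surjective I {k} (lo≤k , k≤hi) = fromℕ< k-lo<size ,
  trans (cong (λ n → lo I + + n) (Fin.toℕ-fromℕ< k-lo<size)) (i≤j⇒i+∣j-i∣≡j lo≤k)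
  where
  k-lo<size : ∣ k - lo I ∣ ℕ.< ∣ I ∣ᵇ
  k-lo<size = s≤s (j≤i+n⇒∣j-i∣≤n lo≤k
    (subst (k ≤_) (sym (i≤j⇒i+∣j-i∣≡j (ℤ.≤-trans lo≤k k≤hi))) k≤hi))

IsBlock-resp-≐ : ∀ {S T : Pred ℤ 0ℓ} {t u} → S ≐ T → IsBlock S t u → IsBlock T t u
IsBlock-resp-≐ (S⊆T , T⊆S) b = record
  { nonempty  = nonempty
  ; contained = S⊆T ∘ contained
  ; maximal   = λ sub sub′ → maximal sub (T⊆S ∘ sub′)
  }
  where open IsBlock b

-- The endpoints are kept and the size depends on them alone, so an offset in a block is, by
-- computation, also an offset in its transport.
Block-resp-≐ : ∀ {S T} → S ≐ T → Block S → Block T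
Block-resp-≐ S≐T (block t u b) = block t u (IsBlock-resp-≐ S≐T b)

#-cong : ∀ S T → ⟦ S ⟧ ≐ ⟦ T ⟧ → # S ≡ # T
#-cong S T (S⊆T , T⊆S) = ℕ.≤-antisym (unique-length-≤ (unique S) S⊆T) (unique-length-≤ (unique T) T⊆S)

-- The interval as an explicit list, which gives it a cardinality to compare with that of `park W`.
[1⋯_] : ℕ → FinSet
[1⋯ n ] = record
  { elements = tabulate {n = n} (λ i → + suc (toℕ i))
  ; unique   = tabulate⁺ (Fin.toℕ-injective ∘ ℕ.suc-injective ∘ ℤ.+-injective)
  }

[1⋯]-≐ : ∀ n → ⟦ [1⋯ n ] ⟧ ≐ [ 1ℤ ⋯ + n ]
[1⋯]-≐ n = to , from
  where
  to : ⟦ [1⋯ n ] ⟧ ⊆ [ 1ℤ ⋯ + n ]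
  to k∈ with ∈-tabulate⁻ k∈
  ... | i , refl = +≤+ (s≤s z≤n) , +≤+ (Fin.toℕ<n i)

  from : [ 1ℤ ⋯ + n ] ⊆ ⟦ [1⋯ n ] ⟧
  from {+ suc k} (_ , +≤+ k<n) =
    subst ⟦ [1⋯ n ] ⟧ (cong (λ i → + suc i) (Fin.toℕ-fromℕ< k<n)) (∈-tabulate⁺ (fromℕ< k<n))
  from {+ zero} (+≤+ () , _)

-- Tree-shaped outcomes and parking words

module _ (𝒫 : ParkingProcedure) where
  open ParkingProcedure 𝒫

  -- The support is both `park W` and the interval from 1 to `#nodes T`; counting its elements in
  -- the two ways gives `#nodes T` = `length W`.
  treeSupport⇒parking : ∀ W → ∃[ T ] shape (Q-forest 𝒫 W) IsTree T → IsParking 𝒫 W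
  treeSupport⇒parking W (T , isTree) = subst (λ n → ⟦ park W ⟧ ≐ [ 1ℤ ⋯ + n ]) #T≡length support-T
    where
    open _IsTree_ isTree
    open ≡-Reasoning
    #T≡length : #nodes T ≡ length W
    #T≡length = begin
      #nodes T            ≡⟨ length-tabulate {n = #nodes T} (λ i → + suc (toℕ i)) ⟨
      # [1⋯ #nodes T ]    ≡⟨ #-cong [1⋯ #nodes T ] (park W) (≐-trans ([1⋯]-≐ (#nodes T)) (≐-sym support-T)) ⟩
      # park W            ≡⟨ #park≡length 𝒫 W ⟩
      length W            ∎

  -- Distinct cars occupy distinct spots

  park-++ : ∀ V U → ⟦ park V ⟧ ⊆ ⟦ park (V ++ U) ⟧
  park-++ V []      k∈ = subst (λ W → _ ∈ ⟦ park W ⟧) (sym (++-identityʳ V)) k∈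
  park-++ V (a ∷ U) k∈ = subst (λ W → _ ∈ ⟦ park W ⟧) (∷ʳ-++ V a U) (park-++ (V ∷ʳ a) U (park-mono V a k∈))

  park-take : ∀ W {m n} → m ℕ.≤ n → ⟦ park (take m W) ⟧ ⊆ ⟦ park (take n W) ⟧
  park-take W {m} {n} m≤n {k} k∈ =
    subst (λ V → k ∈ ⟦ park V ⟧) (take++drop≡id m (take n W))
      (park-++ (take m (take n W)) (drop m (take n W))
        (subst (λ V → k ∈ ⟦ park V ⟧)
          (sym (trans (take-take m n W) (cong (λ l → take l W) (ℕ.m≤n⇒m⊓n≡m m≤n)))) k∈))

  spot∉take : ∀ W i → spot 𝒫 W i ∉ ⟦ park (take (toℕ i) W) ⟧
  spot∉take W i = proj₂ (proj₂ (newSpot 𝒫 (take (toℕ i) W) (lookup W i)))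

  spot∈take : ∀ W i → spot 𝒫 W i ∈ ⟦ park (take (suc (toℕ i)) W) ⟧
  spot∈take W i = subst (λ V → spot 𝒫 W i ∈ ⟦ park V ⟧) (sym (take-suc W i))
    (proj₁ (proj₂ (newSpot 𝒫 (take (toℕ i) W) (lookup W i))))

  spot∈park : ∀ W i → spot 𝒫 W i ∈ ⟦ park W ⟧
  spot∈park W i = subst (λ V → spot 𝒫 W i ∈ ⟦ park V ⟧) (take-all (length W) W ℕ.≤-refl)
    (park-take W (Fin.toℕ<n i) (spot∈take W i))

  -- If car i came before car j, its spot would already be taken on the arrival of car j, which
  -- parks in a free spot.
  spot-injective-≮ : ∀ W {i j} → spot 𝒫 W i ≡ spot 𝒫 W j → toℕ i ℕ.≮ toℕ j
  spot-injective-≮ W {i} {j} eq i<j =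
    spot∉take W j (subst (_∈ ⟦ park (take (toℕ j) W) ⟧) eq (park-take W i<j (spot∈take W i)))

  spot-injective : ∀ W {i j} → spot 𝒫 W i ≡ spot 𝒫 W j → i ≡ j
  spot-injective W {i} {j} eq = Fin.toℕ-injective
    (ℕ.≤-antisym (ℕ.≮⇒≥ (spot-injective-≮ W (sym eq))) (ℕ.≮⇒≥ (spot-injective-≮ W eq)))

  -- Reading cars, letters and spots off the forests

  spot-outcomeAt : ∀ W I j → spot 𝒫 W (outcomeAt 𝒫 W I j) ≡ lo I + + toℕ j
  spot-outcomeAt W I j = proj₂ (parkedAt 𝒫 W (spotOf (park W) I j))

  inorderList-mapForest : ∀ W (f : Fin (length W) → A) I →
    inorderList (tree (mapForest f (decreasingForest 𝒫 W)) I) ≡ tabulate (f ∘ outcomeAt 𝒫 W I)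
  inorderList-mapForest W f I = begin
    inorderList (mapₙ f (decreasingTree (outcomes 𝒫 W I)))   ≡⟨ inorderList-mapₙ f (decreasingTree (outcomes 𝒫 W I)) ⟩
    map f (inorderList (decreasingTree (outcomes 𝒫 W I)))    ≡⟨ cong (map f) (inorderList-decreasingTree′ _ (outcomes 𝒫 W I) _) ⟩
    map f (outcomes 𝒫 W I)                                   ≡⟨ map-tabulate (outcomeAt 𝒫 W I) f ⟩
    tabulate (f ∘ outcomeAt 𝒫 W I)                           ∎
    where open ≡-Reasoning

  -- A single position j of the in-order reading determines both labels: the Q-label is the number
  -- of the car found at offset j of the block, and the canonical label is the spot `lo I` + j.
  canonicalLabel-spot : ∀ W I (ν : Node (tree (Q-forest 𝒫 W) I)) →
                        CarParksIn 𝒫 W (label ν) (canonicalLabel (Q-forest 𝒫 W) I ν)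
  canonicalLabel-spot W I ν =
    let j , label≡ , pos = inorder-tabulate {g = suc ∘ toℕ ∘ outcomeAt 𝒫 W I} (lo I) ν (inorderList-mapForest W (suc ∘ toℕ) I)
    in outcomeAt 𝒫 W I j , label≡ , trans (spot-outcomeAt W I j) pos

  -- The spot of car i lies at some offset j of some block. The car recorded there has the same
  -- spot, hence is car i.
  outcomeAt-surjective : ∀ W i → ∃₂ λ I j → outcomeAt 𝒫 W I j ≡ i
  outcomeAt-surjective W i =
    let t , u , b , spot∈ = blockAround (park W) (spot∈park W i)
        I = block t u b
        j , pos = spotOf-surjective I spot∈
    in I , j , spot-injective W (trans (spot-outcomeAt W I j) pos)

  -- The two blocks share their endpoints, so their trees are equal and have the same in-order
  -- reading, which is compared offset by offset.
  labels-determined : ∀ {W W′} {f : Fin (length W) → A} {g : Fin (length W′) → A}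
    (F≈G : mapForest f (decreasingForest 𝒫 W) ≈ mapForest g (decreasingForest 𝒫 W′)) (I : Block ⟦ park W ⟧) →
    f ∘ outcomeAt 𝒫 W I ≗ g ∘ outcomeAt 𝒫 W′ (Block-resp-≐ (_≈_.support-≈ F≈G) I)
  labels-determined {W = W} {W′} {f} {g} F≈G I = tabulate-injective
    (trans (sym (inorderList-mapForest W f I))
      (trans (cong inorderList (tree-≈ I I′ refl refl)) (inorderList-mapForest W′ g I′)))
    where
    open _≈_ F≈G
    I′ = Block-resp-≐ support-≈ I

  -- The supports give equal lengths. For each car, Q locates the same car number at the same block
  -- and offset for both words, and P then gives its letter there.
  correspondence-injective : ∀ W W′ → correspondence 𝒫 W ≈² correspondence 𝒫 W′ → W ≡ W′
  correspondence-injective W W′ (P≈ , Q≈) = Pointwise-≡⇒≡ (lookup⁻ length≡ λ {i} {i′} i≡i′ →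
    let I , j , car = outcomeAt-surjective W i in sameLetter i≡i′ I j car)
    where
    open ≡-Reasoning

    length≡ : length W ≡ length W′
    length≡ = trans (sym (#park≡length 𝒫 W))
      (trans (#-cong (park W) (park W′) (_≈_.support-≈ P≈)) (#park≡length 𝒫 W′))

    sameLetter : ∀ {i i′} → toℕ i ≡ toℕ i′ → ∀ I j → outcomeAt 𝒫 W I j ≡ i → lookup W i ≡ lookup W′ i′
    sameLetter {i} {i′} i≡i′ I j car = begin
      lookup W i                          ≡⟨ cong (lookup W) car ⟨
      lookup W (outcomeAt 𝒫 W I j)        ≡⟨ labels-determined P≈ I j ⟩
      lookup W′ (outcomeAt 𝒫 W′ I′ j)     ≡⟨ cong (lookup W′) (Fin.toℕ-injective car′) ⟩
      lookup W′ i′                        ∎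
      where
      I′ = Block-resp-≐ (_≈_.support-≈ P≈) I

      -- Equality of the Q-labels, which are car numbers shifted by one, shows that offset j of the
      -- corresponding block holds car i′ of W′.
      car′ : toℕ (outcomeAt 𝒫 W′ I′ j) ≡ toℕ i′
      car′ = begin
        toℕ (outcomeAt 𝒫 W′ I′ j)         ≡⟨ ℕ.suc-injective (labels-determined Q≈ I j) ⟨
        toℕ (outcomeAt 𝒫 W I j)           ≡⟨ cong toℕ car ⟩
        toℕ i                             ≡⟨ i≡i′ ⟩
        toℕ i′                            ∎

proposition5p4 : (𝒫 : ParkingProcedure) → Bilateral 𝒫 →
    ((W : List ℤ) → (∃[ T ] shape (Q-forest 𝒫 W) IsTree T) → IsParking 𝒫 W)
    × ((W W′ : List ℤ) → correspondence 𝒫 W ≈² correspondence 𝒫 W′ → W ≡ W′)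
    × ((W : List ℤ) (I : Block ⟦ support (Q-forest 𝒫 W) ⟧) (ν : Node (tree (Q-forest 𝒫 W) I)) →
    CarParksIn 𝒫 W (label ν) (canonicalLabel (Q-forest 𝒫 W) I ν))
proposition5p4 𝒫 _ = treeSupport⇒parking 𝒫 , correspondence-injective 𝒫 , canonicalLabel-spot 𝒫
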